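{- Let $t\geq 1$, $\ell\geq 3$ and $k\geq t+\ell-2$ be integers. There is $n_0=n_0(k,t,\ell)$ such that for every $n\geq n_0$ the following holds. If $\mathcal{F}\subset\binom{[n]}{k}$ is a family such that $$\binom{\ell}{2}(t-1)+\binom{\ell-1}{2}\leq \sum_{1\leq i<j\leq \ell}|F_i\cap F_j|$$ holds for every choice of $\ell$ distinct members $F_1,\dots,F_\ell$ of $\mathcal{F}$, then $$|\mathcal{F}|\leq \binom{n-t}{k-t}+\binom{n-t-\ell+2}{k-t-\ell+3}.$$
   Context: $[n]=\{1,\dots,n\}$ and $\binom{[n]}{k}$ denotes the family of all $k$-element subsets of $[n]$. -}

module Defs where

open import Data.Nat using (ℕ; _<ᵇ_)
open import Data.Bool using (if_then_else_)
open import Data.Fin using (Fin; toℕ)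
open import Data.List using (map; allFin)
open import Data.Nat.ListAction using (sum)

pairSum : ∀ {ℓ} → (Fin ℓ → Fin ℓ → ℕ) → ℕ
pairSum {ℓ} f =
  sum (map (λ i → sum (map (λ j → if toℕ i <ᵇ toℕ j then f i j else 0) (allFin ℓ))) (allFin ℓ))

{-# OPTIONS --safe #-}
-- Call T rich if for every set X of at most ℓk points some A ∈ F contains T and
-- meets X only inside T. If T is not rich, the members of F containing T are
-- covered by boundedly many sets T ∪ {x}. Branching from ∅, either some rich T
-- with |T| ≤ t appears, or F is covered by boundedly many (t+1)-sets and is too
-- small to matter once n is large. A list of j members of F can be completed to ℓ
-- members by petals of a rich T that meet everything else only inside T. With
-- j = 0 the hypothesis gives |T| = t, with j = 1 it gives |T ∩ B| ≥ t − 1 for all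
-- B ∈ F, and with j = 2 it shows that the members not containing T pairwise meet in
-- at least s = t + ℓ − 3 points. Branching again on these members, either they are
-- covered by boundedly many (s+1)-sets, or they all contain one s-set S with
-- |S ∩ T| = t − 1 and miss the remaining point of T, which leaves at most
-- C(n−s−1, k−s) of them.
module Submission where

open import Defs
open import Data.Nat using (ℕ; _+_; _*_; _∸_; _≤_)
open import Data.Nat.Combinatorics using (_C_)
open import Data.Product using (Σ)
open import Data.Fin using (Fin)
open import Data.Fin.Subset using (Subset; _∩_; ∣_∣)
open import Data.List using (List; length)
open import Data.List.Relation.Unary.All using (All)
open import Data.List.Relation.Unary.Unique.Propositional using (Unique)
open import Data.List.Membership.Propositional using (_∈_)
open import Relation.Binary.PropositionalEquality using (_≡_)
open import Function.Definitions using (Injective)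

open import Data.Bool using (if_then_else_)
import Data.Bool.Properties as Bool
open import Data.Empty using (⊥-elim)
open import Data.Fin using (zero; suc; toℕ)
open import Data.Fin.Properties using (any?)
open import Data.Fin.Subset using (inside; outside; ⊥; ⁅_⁆; ∁; _∪_; ⋃; _⊆_) renaming (_∈_ to _∈ˢ_; _∉_ to _∉ˢ_)
open import Data.Fin.Subset.Properties using (_∈?_; _⊆?_; anySubset?; drop-∷-⊆; ∉⊥; ⊥⊆; ∣⊥∣≡0; p⊆q⇒∣p∣≤∣q∣; p⊂q⇒∣p∣<∣q∣; x∈p∩q⁺; x∈p∩q⁻; p∩q⊆p; p∩q⊆q; ∣p∩q∣≤∣p∣; ∩-comm; ∩-idem; p⊆p∪q; q⊆p∪q; x∈p∪q⁻; ∪-identityʳ; x∈∁p⇒x∉p; x∉p⇒x∈∁p; x∈⁅y⁆⇒x≡y; ∣∁p∣≡n∸∣p∣)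
open import Data.List using ([]; _∷_; _++_; [_]; map; concatMap; filter; lookup; allFin)
open import Data.List.Properties using (length-map; length-++; length-++-sucʳ; map-cong; map-∘; map-tabulate; tabulate-lookup)
open import Data.List.Relation.Unary.All as All using ([]; _∷_; all?)
open import Data.List.Relation.Unary.All.Properties using (¬Any⇒All¬; All¬⇒¬Any)
import Data.List.Relation.Unary.All.Properties as Allₚ
open import Data.List.Relation.Unary.AllPairs using ([]; _∷_)
open import Data.List.Relation.Unary.Any as Any using (Any; here; there)
import Data.List.Relation.Unary.Any.Properties as Anyₚ
open import Data.List.Relation.Unary.Unique.Propositional.Properties using (filter⁺)
open import Data.List.Membership.Propositional using (find; lose)
open import Data.List.Membership.Propositional.Properties using (∈-∃++; ∈-++⁺ˡ; ∈-++⁺ʳ; ∈-++⁻; ∈-map⁺; ∈-map⁻; ∈-lookup; ∈-concatMap⁺; ∈-filter⁻)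
open import Data.Nat using (zero; suc; _<_; _^_; _<ᵇ_; pred; z≤n; s≤s; z<s; _<?_; _≤?_)
open import Data.Nat.Combinatorics using (nC1≡n; k>n⇒nCk≡0; nCk+nC[k+1]≡[n+1]C[k+1])
open import Data.Nat.ListAction using (sum)
open import Data.Nat.Properties
open import Data.Nat.Tactic.RingSolver using (solve-∀)
open import Data.Product using (∃; _×_; _,_; proj₁; proj₂)
open import Data.Sum using (_⊎_; inj₁; inj₂)
open import Data.Vec using ([]; _∷_; here; there)
open import Data.Vec.Properties using (≡-dec)
open import Function using (_∘_; id)
open import Relation.Binary.PropositionalEquality using (refl; sym; trans; cong; cong₂; subst; subst₂)
open import Relation.Nullary using (¬_; Dec; yes; no; contradiction; ¬?; _×-dec_; _→-dec_)

private
  variable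
    n : ℕ
    V : Set

-- Binomial coefficients

private
  absorb-step : ∀ r d a b c → suc r * a ≡ suc d * b → suc (suc r) * c ≡ d * a →
    suc (suc r) * (a + c) ≡ suc d * (b + a)
  absorb-step r d a b c eq₁ eq₂ = trans (lhs r a c) (trans (cong₂ (λ x y → a + x + y) eq₁ eq₂) (rhs d a b))
    where
    lhs : ∀ r a c → suc (suc r) * (a + c) ≡ a + suc r * a + suc (suc r) * c
    lhs = solve-∀
    rhs : ∀ d a b → a + suc d * b + d * a ≡ suc d * (b + a)
    rhs = solve-∀

-- Induction along Pascal's rule. The difference m - r enters as the variable `d`, so no truncated
-- subtraction occurs.
C-absorb : ∀ r d m → m ≡ r + d → suc r * (m C suc r) ≡ d * (m C r)
C-absorb zero d .d refl = trans (+-identityʳ _) (trans (nC1≡n d) (sym (*-identityʳ d)))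
C-absorb (suc r) zero m refl =
  trans (cong (suc (suc r) *_) (k>n⇒nCk≡0 (s≤s (s≤s (≤-reflexive (+-identityʳ r)))))) (*-zeroʳ (suc (suc r)))
C-absorb (suc r) (suc d) (suc m) refl =
  trans (cong (suc (suc r) *_) (sym (nCk+nC[k+1]≡[n+1]C[k+1] m (suc r))))
    (trans (absorb-step r d (m C suc r) (m C r) (m C suc (suc r)) (C-absorb r (suc d) m refl)
             (C-absorb (suc r) d m (+-suc r d)))
           (cong (suc d *_) (nCk+nC[k+1]≡[n+1]C[k+1] m r)))

-- By absorption C(m, r + 1) is C(m, r) times (m - r)/(r + 1), a factor of at least `M` here. This
-- absorbs boundedly many lower-order terms once n is large.
C-grows : ∀ M r m → M * suc r + r ≤ m → M * (m C r) ≤ m C suc r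
C-grows M r m large = *-cancelˡ-≤ (suc r) (begin
  suc r * (M * (m C r))  ≡⟨ *-assoc (suc r) M (m C r) ⟨
  suc r * M * (m C r)    ≡⟨ cong (_* (m C r)) (*-comm (suc r) M) ⟩
  M * suc r * (m C r)    ≤⟨ *-monoˡ-≤ (m C r) (m+n≤o⇒m≤o∸n (M * suc r) large) ⟩
  (m ∸ r) * (m C r)      ≡⟨ C-absorb r (m ∸ r) m (sym (m+[n∸m]≡n (m+n≤o⇒n≤o (M * suc r) large))) ⟨
  suc r * (m C suc r)    ∎)
  where open ≤-Reasoning

C-mono-suc : ∀ m r → m C suc r ≤ suc m C suc r
C-mono-suc m r = ≤-trans (m≤n+m (m C suc r) (m C r)) (≤-reflexive (nCk+nC[k+1]≡[n+1]C[k+1] m r))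

C-mono-pred : ∀ m r → pred m C suc r ≤ m C suc r
C-mono-pred zero r = ≤-refl
C-mono-pred (suc m) r = C-mono-suc m r

-- C(m, 2) by recursion: a new petal forms a pair with each of the `m` others.
triangle : ℕ → ℕ
triangle zero = 0
triangle (suc m) = m + triangle m

nC2≡triangle : ∀ m → m C 2 ≡ triangle m
nC2≡triangle zero = refl
nC2≡triangle (suc m) =
  trans (sym (nCk+nC[k+1]≡[n+1]C[k+1] m 1)) (cong₂ _+_ (nC1≡n m) (nC2≡triangle m))

-- Lists

unique⇒length≤ : {xs ys : List V} → Unique xs → (∀ {x} → x ∈ xs → x ∈ ys) → length xs ≤ length ys
unique⇒length≤ [] _ = z≤n
unique⇒length≤ {xs = x ∷ xs} (x∉xs ∷ uniq) sub with ∈-∃++ (sub (here refl))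
... | as , bs , refl = ≤-trans (s≤s (unique⇒length≤ uniq sub′)) (≤-reflexive (sym (length-++-sucʳ as x bs)))
  where
  sub′ : ∀ {y} → y ∈ xs → y ∈ as ++ bs
  sub′ y∈xs with ∈-++⁻ as (sub (there y∈xs))
  ... | inj₁ y∈as = ∈-++⁺ˡ y∈as
  ... | inj₂ (there y∈bs) = ∈-++⁺ʳ as y∈bs
  ... | inj₂ (here refl) = contradiction y∈xs (All¬⇒¬Any x∉xs)

length-concatMap-≡ : {Y : Set} (f : V → List Y) {c : ℕ} {xs : List V} → All (λ x → length (f x) ≡ c) xs →
  length (concatMap f xs) ≡ length xs * c
length-concatMap-≡ f [] = refl
length-concatMap-≡ f {xs = x ∷ _} (eq ∷ eqs) = trans (length-++ (f x)) (cong₂ _+_ eq (length-concatMap-≡ f eqs))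

[]-or-∈ : (xs : List V) → xs ≡ [] ⊎ ∃ (_∈ xs)
[]-or-∈ [] = inj₁ refl
[]-or-∈ (x ∷ _) = inj₂ (x , here refl)

length-filter-split : {P : V → Set} (P? : ∀ x → Dec (P x)) (xs : List V) →
  length xs ≡ length (filter P? xs) + length (filter (¬? ∘ P?) xs)
length-filter-split P? [] = refl
length-filter-split P? (x ∷ xs) with P? x
... | yes _ = cong suc (length-filter-split P? xs)
... | no _ = trans (cong suc (length-filter-split P? xs)) (sym (+-suc _ _))

lookup-unique-injective : {xs : List V} → Unique xs → Injective _≡_ _≡_ (lookup xs)
lookup-unique-injective (_ ∷ _) {zero} {zero} _ = refl
lookup-unique-injective (x∉xs ∷ _) {zero} {suc j} eq =
  contradiction (subst (_∈ _) (sym eq) (∈-lookup j)) (All¬⇒¬Any x∉xs)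
lookup-unique-injective (x∉xs ∷ _) {suc i} {zero} eq =
  contradiction (subst (_∈ _) eq (∈-lookup i)) (All¬⇒¬Any x∉xs)
lookup-unique-injective (_ ∷ uniq) {suc i} {suc j} eq = cong suc (lookup-unique-injective uniq eq)

-- Subsets

∣p∪⁅x⁆∣≡1+∣p∣ : (p : Subset n) {x : Fin n} → x ∉ˢ p → ∣ p ∪ ⁅ x ⁆ ∣ ≡ suc ∣ p ∣
∣p∪⁅x⁆∣≡1+∣p∣ (inside ∷ p) {zero} x∉p = contradiction here x∉p
∣p∪⁅x⁆∣≡1+∣p∣ (outside ∷ p) {zero} _ = cong (suc ∘ ∣_∣) (∪-identityʳ p)
∣p∪⁅x⁆∣≡1+∣p∣ (inside ∷ p) {suc x} x∉p = cong suc (∣p∪⁅x⁆∣≡1+∣p∣ p (x∉p ∘ there))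
∣p∪⁅x⁆∣≡1+∣p∣ (outside ∷ p) {suc x} x∉p = ∣p∪⁅x⁆∣≡1+∣p∣ p (x∉p ∘ there)

∣p∪q∣≤∣p∣+∣q∣ : (p q : Subset n) → ∣ p ∪ q ∣ ≤ ∣ p ∣ + ∣ q ∣
∣p∪q∣≤∣p∣+∣q∣ [] [] = z≤n
∣p∪q∣≤∣p∣+∣q∣ (outside ∷ p) (outside ∷ q) = ∣p∪q∣≤∣p∣+∣q∣ p q
∣p∪q∣≤∣p∣+∣q∣ (outside ∷ p) (inside ∷ q) =
  ≤-trans (s≤s (∣p∪q∣≤∣p∣+∣q∣ p q)) (≤-reflexive (sym (+-suc ∣ p ∣ ∣ q ∣)))
∣p∪q∣≤∣p∣+∣q∣ (inside ∷ p) (outside ∷ q) = s≤s (∣p∪q∣≤∣p∣+∣q∣ p q)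
∣p∪q∣≤∣p∣+∣q∣ (inside ∷ p) (inside ∷ q) =
  s≤s (≤-trans (∣p∪q∣≤∣p∣+∣q∣ p q) (+-monoʳ-≤ ∣ p ∣ (n≤1+n ∣ q ∣)))

⊈⇒∃ : (p q : Subset n) → ¬ (p ⊆ q) → ∃ λ x → x ∈ˢ p × x ∉ˢ q
⊈⇒∃ p q p⊈q with any? (λ x → (x ∈? p) ×-dec ¬? (x ∈? q))
... | yes found = found
... | no none = ⊥-elim (p⊈q p⊆q)
  where
  p⊆q : p ⊆ q
  p⊆q {x} x∈p with x ∈? q
  ... | yes x∈q = x∈q
  ... | no x∉q = contradiction (x , x∈p , x∉q) none

∣p∣≤∣p∩q∣⇒p⊆q : (p q : Subset n) → ∣ p ∣ ≤ ∣ p ∩ q ∣ → p ⊆ q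
∣p∣≤∣p∩q∣⇒p⊆q p q le {x} x∈p with x ∈? q
... | yes x∈q = x∈q
... | no x∉q = contradiction le
  (<⇒≱ (p⊂q⇒∣p∣<∣q∣ ((λ {y} → p∩q⊆p p q {y}) , x , x∈p , x∉q ∘ p∩q⊆q p q)))

-- Otherwise `q ∩ r` would lie in `p ∩ r`, which is too small. In branching this makes `r` a
-- blocking set for `p`.
∣∩∣<⇒∩⊈ : ∀ {c} (p q r : Subset n) → c ≤ ∣ q ∩ r ∣ → ∣ p ∩ r ∣ < c → ¬ (q ∩ r ⊆ p)
∣∩∣<⇒∩⊈ p q r c≤q∩r p∩r<c q∩r⊆p = <⇒≱ p∩r<c (≤-trans c≤q∩r
  (p⊆q⇒∣p∣≤∣q∣ {p = q ∩ r} {q = p ∩ r} λ x∈ → x∈p∩q⁺ (q∩r⊆p x∈ , p∩q⊆q q r x∈)))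

elements : Subset n → List (Fin n)
elements [] = []
elements (inside ∷ p) = zero ∷ map suc (elements p)
elements (outside ∷ p) = map suc (elements p)

length-elements : (p : Subset n) → length (elements p) ≡ ∣ p ∣
length-elements [] = refl
length-elements (inside ∷ p) = cong suc (trans (length-map suc (elements p)) (length-elements p))
length-elements (outside ∷ p) = trans (length-map suc (elements p)) (length-elements p)

∈-elements⁺ : {p : Subset n} {x : Fin n} → x ∈ˢ p → x ∈ elements p
∈-elements⁺ {p = inside ∷ p} here = here refl
∈-elements⁺ {p = inside ∷ p} (there x∈p) = there (∈-map⁺ suc (∈-elements⁺ x∈p))
∈-elements⁺ {p = outside ∷ p} (there x∈p) = ∈-map⁺ suc (∈-elements⁺ x∈p)

∈-elements⁻ : (p : Subset n) {x : Fin n} → x ∈ elements p → x ∈ˢ p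
∈-elements⁻ (inside ∷ p) (here refl) = here
∈-elements⁻ (inside ∷ p) (there x∈) with ∈-map⁻ suc x∈
... | y , y∈ , refl = there (∈-elements⁻ p y∈)
∈-elements⁻ (outside ∷ p) x∈ with ∈-map⁻ suc x∈
... | y , y∈ , refl = there (∈-elements⁻ p y∈)

-- Counting sets with prescribed elements

-- On P ∩ R the requirement to contain P wins over the one to avoid R.
extensions : Subset n → Subset n → ℕ → List (Subset n)
extensions [] [] zero = [ [] ]
extensions [] [] (suc r) = []
extensions (inside ∷ P) (_ ∷ R) r = map (inside ∷_) (extensions P R r)
extensions (outside ∷ P) (inside ∷ R) r = map (outside ∷_) (extensions P R r)
extensions (outside ∷ P) (outside ∷ R) zero = map (outside ∷_) (extensions P R zero)
extensions (outside ∷ P) (outside ∷ R) (suc r) =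
  map (inside ∷_) (extensions P R r) ++ map (outside ∷_) (extensions P R (suc r))

-- The `r` added points are chosen freely outside `P ∪ R`; each free position gives the two terms of
-- Pascal's rule.
length-extensions : (P R : Subset n) (r : ℕ) → length (extensions P R r) ≡ ∣ ∁ (P ∪ R) ∣ C r
length-extensions [] [] zero = refl
length-extensions [] [] (suc r) = refl
length-extensions (inside ∷ P) (_ ∷ R) r = trans (length-map _ (extensions P R r)) (length-extensions P R r)
length-extensions (outside ∷ P) (inside ∷ R) r = trans (length-map _ (extensions P R r)) (length-extensions P R r)
length-extensions (outside ∷ P) (outside ∷ R) zero =
  trans (length-map _ (extensions P R zero)) (length-extensions P R zero)
length-extensions (outside ∷ P) (outside ∷ R) (suc r) =
  trans (length-++ (map (inside ∷_) (extensions P R r)))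
    (trans (cong₂ _+_ (trans (length-map _ (extensions P R r)) (length-extensions P R r))
                      (trans (length-map _ (extensions P R (suc r))) (length-extensions P R (suc r))))
           (nCk+nC[k+1]≡[n+1]C[k+1] ∣ ∁ (P ∪ R) ∣ r))

∈-extensions : (P R A : Subset n) (r : ℕ) → P ⊆ A → A ⊆ ∁ R → ∣ A ∣ ≡ ∣ P ∣ + r → A ∈ extensions P R r
∈-extensions [] [] [] zero _ _ _ = here refl
∈-extensions [] [] [] (suc r) _ _ ()
∈-extensions (inside ∷ P) (_ ∷ R) (outside ∷ A) r P⊆A _ _ = contradiction (P⊆A here) λ ()
∈-extensions (inside ∷ P) (_ ∷ R) (inside ∷ A) r P⊆A A⊆∁R eq =
  ∈-map⁺ _ (∈-extensions P R A r (drop-∷-⊆ P⊆A) (drop-∷-⊆ A⊆∁R) (suc-injective eq))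
∈-extensions (outside ∷ P) (inside ∷ R) (inside ∷ A) r _ A⊆∁R _ = contradiction (A⊆∁R here) λ ()
∈-extensions (outside ∷ P) (inside ∷ R) (outside ∷ A) r P⊆A A⊆∁R eq =
  ∈-map⁺ _ (∈-extensions P R A r (drop-∷-⊆ P⊆A) (drop-∷-⊆ A⊆∁R) eq)
∈-extensions (outside ∷ P) (outside ∷ R) (inside ∷ A) zero P⊆A _ eq =
  contradiction (p⊆q⇒∣p∣≤∣q∣ {p = P} {q = A} (drop-∷-⊆ P⊆A)) (<⇒≱ (≤-reflexive (trans eq (+-identityʳ ∣ P ∣))))
∈-extensions (outside ∷ P) (outside ∷ R) (outside ∷ A) zero P⊆A A⊆∁R eq =
  ∈-map⁺ _ (∈-extensions P R A zero (drop-∷-⊆ P⊆A) (drop-∷-⊆ A⊆∁R) eq)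
∈-extensions (outside ∷ P) (outside ∷ R) (inside ∷ A) (suc r) P⊆A A⊆∁R eq =
  ∈-++⁺ˡ (∈-map⁺ _ (∈-extensions P R A r (drop-∷-⊆ P⊆A) (drop-∷-⊆ A⊆∁R) (suc-injective (trans eq (+-suc ∣ P ∣ r)))))
∈-extensions (outside ∷ P) (outside ∷ R) (outside ∷ A) (suc r) P⊆A A⊆∁R eq =
  ∈-++⁺ʳ (map (inside ∷_) (extensions P R r))
    (∈-map⁺ _ (∈-extensions P R A (suc r) (drop-∷-⊆ P⊆A) (drop-∷-⊆ A⊆∁R) eq))

Covers : List (Subset n) → List (Subset n) → Set
Covers Ts F = ∀ {A} → A ∈ F → Any (_⊆ A) Ts

-- Union bound: an `i`-set has C(n - i, r) supersets of size `i + r`.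
covered⇒length≤ : ∀ i r (F Ts : List (Subset n)) → Unique F → (∀ {A} → A ∈ F → ∣ A ∣ ≡ i + r) →
  All (λ T → ∣ T ∣ ≡ i) Ts → Covers Ts F → length F ≤ length Ts * ((n ∸ i) C r)
covered⇒length≤ {n} i r F Ts uniq size sizes cover =
  ≤-trans (unique⇒length≤ uniq member) (≤-reflexive (length-concatMap-≡ supersets (All.map (λ {T} → length-supersets T) sizes)))
  where
  supersets : Subset n → List (Subset n)
  supersets T = extensions T ⊥ r
  length-supersets : ∀ T → ∣ T ∣ ≡ i → length (supersets T) ≡ (n ∸ i) C r
  length-supersets T refl = trans (length-extensions T ⊥ r)
    (cong (_C r) (trans (cong (∣_∣ ∘ ∁) (∪-identityʳ T)) (∣∁p∣≡n∸∣p∣ T)))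
  member : ∀ {A} → A ∈ F → A ∈ concatMap supersets Ts
  member {A} A∈F with find (cover A∈F)
  ... | T , T∈Ts , T⊆A = ∈-concatMap⁺ supersets (lose T∈Ts
    (∈-extensions T ⊥ A r T⊆A (λ _ → x∉p⇒x∈∁p ∉⊥)
      (trans (size A∈F) (cong (_+ r) (sym (All.lookup sizes T∈Ts))))))

contain-avoid⇒length≤ : ∀ r (F : List (Subset n)) (S : Subset n) (y : Fin n) → Unique F →
  (∀ {A} → A ∈ F → ∣ A ∣ ≡ ∣ S ∣ + r) → y ∉ˢ S →
  (∀ {A} → A ∈ F → S ⊆ A) → (∀ {A} → A ∈ F → y ∉ˢ A) → length F ≤ (n ∸ suc ∣ S ∣) C r
contain-avoid⇒length≤ {n} r F S y uniq size y∉S contain avoid =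
  ≤-trans (unique⇒length≤ uniq member)
    (≤-reflexive (trans (length-extensions S ⁅ y ⁆ r)
      (cong (_C r) (trans (∣∁p∣≡n∸∣p∣ (S ∪ ⁅ y ⁆)) (cong (n ∸_) (∣p∪⁅x⁆∣≡1+∣p∣ S y∉S))))))
  where
  member : ∀ {A} → A ∈ F → A ∈ extensions S ⁅ y ⁆ r
  member {A} A∈F = ∈-extensions S ⁅ y ⁆ A r (contain A∈F)
    (λ x∈A → x∉p⇒x∈∁p (λ x∈⁅y⁆ → avoid A∈F (subst (_∈ˢ A) (x∈⁅y⁆⇒x≡y y x∈⁅y⁆) x∈A)))
    (size A∈F)

-- Branching

-- `Good` stays abstract because branching runs twice: on all of `F` with rich sets, and on the
-- members not containing the kernel `T`.
module Branching {n} (F : List (Subset n)) (N : ℕ) (Good : Subset n → Set)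
  (step : ∀ T → Good T ⊎ ∃ λ X → ∣ X ∣ ≤ N × (∀ {A} → A ∈ F → T ⊆ A → ¬ (A ∩ X ⊆ T))) where

  -- A set `T` that is not good is replaced by the at most `N` sets `T ∪ ⁅ x ⁆` with x in `X`
  -- outside `T`. A member above `T` has such a point x, so it stays covered.
  refine : ∀ i Ts → All (λ T → ∣ T ∣ ≡ i) Ts → (∃ λ T → ∣ T ∣ ≤ i × Good T) ⊎
    ∃ λ Ts′ → length Ts′ ≤ length Ts * N × All (λ T → ∣ T ∣ ≡ suc i) Ts′ ×
      (∀ {A} → A ∈ F → Any (_⊆ A) Ts → Any (_⊆ A) Ts′)
  refine i [] [] = inj₂ ([] , z≤n , [] , λ _ ())
  refine i (T ∷ Ts) (eq ∷ eqs) with step T | refine i Ts eqs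
  ... | inj₁ good | _ = inj₁ (T , ≤-reflexive eq , good)
  ... | inj₂ _ | inj₁ found = inj₁ found
  ... | inj₂ (X , small , meets) | inj₂ (Ts′ , len , sizes , cover) =
    inj₂ (children ++ Ts′ , length≤ , Allₚ.++⁺ children-size sizes , cover′)
    where
    children : List (Subset n)
    children = map (λ x → T ∪ ⁅ x ⁆) (elements (X ∩ ∁ T))
    length-children : length children ≡ ∣ X ∩ ∁ T ∣
    length-children = trans (length-map _ (elements (X ∩ ∁ T))) (length-elements (X ∩ ∁ T))
    length≤ : length (children ++ Ts′) ≤ N + length Ts * N
    length≤ = ≤-trans (≤-reflexive (trans (length-++ children) (cong (_+ length Ts′) length-children)))
      (+-mono-≤ (≤-trans (∣p∩q∣≤∣p∣ X (∁ T)) small) len)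
    children-size : All (λ U → ∣ U ∣ ≡ suc i) children
    children-size = Allₚ.map⁺ (All.tabulate λ x∈ → trans
      (∣p∪⁅x⁆∣≡1+∣p∣ T (x∈∁p⇒x∉p (proj₂ (x∈p∩q⁻ X (∁ T) (∈-elements⁻ (X ∩ ∁ T) x∈))))) (cong suc eq))
    cover′ : ∀ {A} → A ∈ F → Any (_⊆ A) (T ∷ Ts) → Any (_⊆ A) (children ++ Ts′)
    cover′ A∈F (there below) = Anyₚ.++⁺ʳ children (cover A∈F below)
    cover′ {A} A∈F (here T⊆A) with ⊈⇒∃ (A ∩ X) T (meets A∈F T⊆A)
    ... | x , x∈A∩X , x∉T = Anyₚ.++⁺ˡ (Anyₚ.map⁺ (lose (∈-elements⁺ (x∈p∩q⁺ (x∈X , x∉p⇒x∈∁p x∉T))) below))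
      where
      x∈A = proj₁ (x∈p∩q⁻ A X x∈A∩X)
      x∈X = proj₂ (x∈p∩q⁻ A X x∈A∩X)
      below : T ∪ ⁅ x ⁆ ⊆ A
      below y∈ with x∈p∪q⁻ T ⁅ x ⁆ y∈
      ... | inj₁ y∈T = T⊆A y∈T
      ... | inj₂ y∈⁅x⁆ = subst (_∈ˢ A) (sym (x∈⁅y⁆⇒x≡y x y∈⁅x⁆)) x∈A

  -- Refinement starts from the empty set, which lies below every member, and each level costs a
  -- factor `N`.
  good-or-cover : ∀ i → (∃ λ T → ∣ T ∣ < i × Good T) ⊎
    ∃ λ Ts → length Ts ≤ N ^ i × All (λ T → ∣ T ∣ ≡ i) Ts × Covers Ts F
  good-or-cover zero = inj₂ ([ ⊥ ] , ≤-refl , ∣⊥∣≡0 n ∷ [] , λ _ → here ⊥⊆)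
  good-or-cover (suc i) with good-or-cover i
  ... | inj₁ (T , small , good) = inj₁ (T , m<n⇒m<1+n small , good)
  ... | inj₂ (Ts , len , sizes , cover) with refine i Ts sizes
  ...   | inj₁ (T , small , good) = inj₁ (T , s≤s small , good)
  ...   | inj₂ (Ts′ , len′ , sizes′ , cover′) = inj₂ (Ts′ ,
    ≤-trans len′ (≤-trans (*-monoˡ-≤ N len) (≤-reflexive (*-comm (N ^ i) N))) , sizes′ ,
    λ A∈F → cover′ A∈F (cover A∈F))

-- Sums of pairwise intersections

-- List form of `pairSum`; its recursion matches adding one petal in front.
pairTotal : List (Subset n) → ℕ
pairTotal [] = 0
pairTotal (A ∷ L) = sum (map (λ B → ∣ A ∩ B ∣) L) + pairTotal L

sum-allFin-suc : ∀ {m} (f : Fin (suc m) → ℕ) →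
  sum (map f (allFin (suc m))) ≡ f zero + sum (map (f ∘ suc) (allFin m))
sum-allFin-suc f = cong (λ xs → f zero + sum xs) (trans (map-tabulate suc f) (sym (map-tabulate id (f ∘ suc))))

-- Column zero vanishes because no index is below zero, and shifting both indices preserves their
-- order; both hold by computation.
pairSum-suc : ∀ {m} (f : Fin (suc m) → Fin (suc m) → ℕ) →
  pairSum f ≡ sum (map (f zero ∘ suc) (allFin m)) + pairSum (λ i j → f (suc i) (suc j))
pairSum-suc {m} f = trans (sum-allFin-suc row) (cong₂ _+_ (sum-allFin-suc (entry zero))
  (cong sum (map-cong (λ i → sum-allFin-suc (entry (suc i))) (allFin m))))
  where
  entry : Fin (suc m) → Fin (suc m) → ℕ
  entry i j = if toℕ i <ᵇ toℕ j then f i j else 0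
  row : Fin (suc m) → ℕ
  row i = sum (map (entry i) (allFin (suc m)))

pairSum-lookup : (L : List (Subset n)) → pairSum (λ i j → ∣ lookup L i ∩ lookup L j ∣) ≡ pairTotal L
pairSum-lookup [] = refl
pairSum-lookup (A ∷ L) = trans (pairSum-suc (λ i j → ∣ lookup (A ∷ L) i ∩ lookup (A ∷ L) j ∣))
  (cong₂ _+_ (cong sum row) (pairSum-lookup L))
  where
  row : map (λ j → ∣ A ∩ lookup L j ∣) (allFin (length L)) ≡ map (λ B → ∣ A ∩ B ∣) L
  row = trans (map-∘ (allFin (length L)))
    (cong (map (λ B → ∣ A ∩ B ∣)) (trans (map-tabulate id (lookup L)) (tabulate-lookup L)))

sum-map-≤ : (f g : V → ℕ) (xs : List V) → (∀ {x} → x ∈ xs → f x ≤ g x) → sum (map f xs) ≤ sum (map g xs)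
sum-map-≤ f g [] _ = z≤n
sum-map-≤ f g (x ∷ xs) le = +-mono-≤ (le (here refl)) (sum-map-≤ f g xs (le ∘ there))

∣⋃∣≤ : ∀ {k} {L : List (Subset n)} → All (λ A → ∣ A ∣ ≡ k) L → ∣ ⋃ L ∣ ≤ length L * k
∣⋃∣≤ {n} [] = ≤-reflexive (∣⊥∣≡0 n)
∣⋃∣≤ {L = A ∷ L} (eq ∷ eqs) =
  ≤-trans (∣p∪q∣≤∣p∣+∣q∣ A (⋃ L)) (+-mono-≤ (≤-reflexive eq) (∣⋃∣≤ eqs))

∈⇒⊆⋃ : {A : Subset n} {L : List (Subset n)} → A ∈ L → A ⊆ ⋃ L
∈⇒⊆⋃ {L = _ ∷ L} (here refl) = p⊆p∪q (⋃ L)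
∈⇒⊆⋃ {L = B ∷ L} (there A∈L) x∈A = q⊆p∪q B (⋃ L) (∈⇒⊆⋃ A∈L x∈A)

-- Rich sets

Rich : List (Subset n) → ℕ → Subset n → Set
Rich F N T = ∀ X → ∣ X ∣ ≤ N → ∃ λ A → A ∈ F × T ⊆ A × A ∩ X ⊆ T

-- Only finitely many `X` have to be tested. The second alternative is what `Branching` requires of
-- a set that is not good.
rich-or-blocked : (F : List (Subset n)) (N : ℕ) (T : Subset n) →
  Rich F N T ⊎ ∃ λ X → ∣ X ∣ ≤ N × (∀ {A} → A ∈ F → T ⊆ A → ¬ (A ∩ X ⊆ T))
rich-or-blocked {n} F N T with anySubset? (λ X → (∣ X ∣ ≤? N) ×-dec all? (blocked? X) F)
  where
  blocked? : ∀ X A → Dec (T ⊆ A → ¬ (A ∩ X ⊆ T))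
  blocked? X A = (T ⊆? A) →-dec ¬? ((A ∩ X) ⊆? T)
... | yes (X , small , blocked) = inj₂ (X , small , All.lookup blocked)
... | no none = inj₁ rich
  where
  free? : ∀ X A → Dec (T ⊆ A × A ∩ X ⊆ T)
  free? X A = (T ⊆? A) ×-dec ((A ∩ X) ⊆? T)
  rich : Rich F N T
  rich X small with Any.any? (free? X) F
  ... | yes found = find found
  ... | no ¬found = contradiction
    (X , small , All.map (λ ¬free T⊆A A∩X⊆T → ¬free (T⊆A , A∩X⊆T)) (¬Any⇒All¬ F ¬found)) none

-- Petals of T are added one at a time, each meeting all earlier sets only inside T.
add-petals : ∀ {F : List (Subset n)} {k ℓ T} → (∀ {A} → A ∈ F → ∣ A ∣ ≡ k) → ∣ T ∣ < k → Rich F (ℓ * k) T →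
  ∀ m L → m + length L ≤ ℓ → Unique L → All (_∈ F) L →
  ∃ λ L′ → length L′ ≡ m + length L × Unique L′ × All (_∈ F) L′ ×
    pairTotal L′ ≤ pairTotal L + m * sum (map (λ B → ∣ T ∩ B ∣) L) + triangle m * ∣ T ∣
add-petals size T<k rich zero L _ uniq L⊆F = L , refl , uniq , L⊆F ,
  ≤-reflexive (sym (trans (+-identityʳ _) (+-identityʳ _)))
add-petals {F = F} {k} {ℓ} {T} size T<k rich (suc m) L fits uniq L⊆F
  -- At most ℓ members of size `k` are in use, so their union is small enough for richness.
  with rich (⋃ L) (≤-trans (∣⋃∣≤ (All.map size L⊆F)) (*-monoˡ-≤ k (≤-trans (m≤n+m (length L) (suc m)) fits)))
... | A , A∈F , T⊆A , A∩⋃L⊆T with add-petals {ℓ = ℓ} size T<k rich m (A ∷ L)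
        (≤-trans (≤-reflexive (+-suc m (length L))) fits) (¬Any⇒All¬ L A∉L ∷ uniq) (A∈F ∷ L⊆F)
  where
  -- A member of `L` lies inside `⋃ L`, so `A` would lie inside `T`, which has fewer than `k`
  -- points.
  A∉L : ¬ (A ∈ L)
  A∉L A∈L = <⇒≱ T<k (subst (_≤ ∣ T ∣) (size A∈F)
    (p⊆q⇒∣p∣≤∣q∣ {p = A} {q = T} (λ x∈A → A∩⋃L⊆T (x∈p∩q⁺ (x∈A , ∈⇒⊆⋃ A∈L x∈A)))))
... | L′ , len , uniq′ , L′⊆F , total = L′ , trans len (+-suc m (length L)) , uniq′ , L′⊆F , (begin
  pairTotal L′
    ≤⟨ total ⟩
  sum (map (λ B → ∣ A ∩ B ∣) L) + pairTotal L + m * (∣ T ∩ A ∣ + w) + triangle m * ∣ T ∣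
    -- `A` meets the earlier sets only inside `T`, and each of the `m` later petals is charged at
    -- most |T| for its intersection with `A`.
    ≤⟨ +-monoˡ-≤ _ (+-mono-≤ (+-monoˡ-≤ _ (sum-map-≤ _ _ L meets)) (*-monoʳ-≤ m (+-monoˡ-≤ w (∣p∩q∣≤∣p∣ T A)))) ⟩
  w + pairTotal L + m * (∣ T ∣ + w) + triangle m * ∣ T ∣
    ≡⟨ rearrange (pairTotal L) m w (triangle m) ∣ T ∣ ⟩
  pairTotal L + suc m * w + triangle (suc m) * ∣ T ∣ ∎)
  where
  open ≤-Reasoning
  w : ℕ
  w = sum (map (λ B → ∣ T ∩ B ∣) L)
  meets : ∀ {B} → B ∈ L → ∣ A ∩ B ∣ ≤ ∣ T ∩ B ∣
  meets {B} B∈L = p⊆q⇒∣p∣≤∣q∣ {p = A ∩ B} {q = T ∩ B} λ x∈A∩B →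
    let x∈A , x∈B = x∈p∩q⁻ A B x∈A∩B in x∈p∩q⁺ (A∩⋃L⊆T (x∈p∩q⁺ (x∈A , ∈⇒⊆⋃ B∈L x∈B)) , x∈B)
  rearrange : ∀ P m w c t → w + P + m * (t + w) + c * t ≡ P + suc m * w + (m + c) * t
  rearrange = solve-∀

-- Comparison of intersection sums, for ℓ = 3 + p and t = 1 + u

private
  no-smaller-kernel : ∀ c d u x → 0 < d → x ≤ u → ¬ (c * u + d ≤ c * x)
  no-smaller-kernel c d u x d>0 x≤u = <⇒≱ (≤-<-trans (*-monoʳ-≤ c x≤u) (m<m+n (c * u) d>0))

  -- One member and ℓ - 1 petals, with c = C(ℓ - 1, 2). Since C(ℓ, 2) = (ℓ - 1) + c, cancelling
  -- leaves (ℓ - 1) u ≤ (ℓ - 1) b.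
  one-outsider : ∀ p c u b → (2 + p + c) * u + c ≤ 0 + (2 + p) * (b + 0) + c * suc u → u ≤ b
  one-outsider p c u b le = *-cancelˡ-≤ (2 + p)
    (+-cancelʳ-≤ (c * u + c) ((2 + p) * u) ((2 + p) * b) (subst₂ _≤_ (lhs p c u) (rhs p c u b) le))
    where
    lhs : ∀ p c u → (2 + p + c) * u + c ≡ (2 + p) * u + (c * u + c)
    lhs = solve-∀
    rhs : ∀ p c u b → 0 + (2 + p) * (b + 0) + c * suc u ≡ (2 + p) * b + (c * u + c)
    rhs = solve-∀

  -- Two members and ℓ - 2 petals, with c = C(ℓ - 2, 2). Since C(ℓ, 2) = 1 + 2(ℓ - 2) + c and C(ℓ -
  -- 1, 2) = (ℓ - 2) + c, what remains below `x` is u + (ℓ - 2), the number s.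
  two-outsiders : ∀ p c u x b₁ b₂ → b₁ ≤ u → b₂ ≤ u →
    (2 + p + (1 + p + c)) * u + (1 + p + c) ≤ x + 0 + 0 + (1 + p) * (b₁ + (b₂ + 0)) + c * suc u →
    suc (u + p) ≤ x
  two-outsiders p c u x b₁ b₂ b₁≤u b₂≤u le = +-cancelʳ-≤ R (suc (u + p)) x
    (subst₂ _≤_ (lhs p c u) (rhs p c u x) (≤-trans le
      (+-monoˡ-≤ (c * suc u) (+-monoʳ-≤ (x + 0 + 0) (*-monoʳ-≤ (1 + p) (+-mono-≤ b₁≤u (+-monoˡ-≤ 0 b₂≤u)))))))
    where
    R : ℕ
    R = (1 + p) * (u + u) + (c * u + c)
    lhs : ∀ p c u → (2 + p + (1 + p + c)) * u + (1 + p + c) ≡ suc (u + p) + ((1 + p) * (u + u) + (c * u + c))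
    lhs = solve-∀
    rhs : ∀ p c u x → x + 0 + 0 + (1 + p) * (u + (u + 0)) + c * suc u ≡ x + ((1 + p) * (u + u) + (c * u + c))
    rhs = solve-∀

-- With t = 1 + u, ℓ = 3 + p and k = t + ℓ − 2 + q.
module Bound {n} (u p q : ℕ) (F : List (Subset n)) (uniq : Unique F)
  (size : ∀ {A} → A ∈ F → ∣ A ∣ ≡ suc (suc (u + p)) + q)
  (dense : ∀ L → length L ≡ 3 + p → Unique L → All (_∈ F) L →
    triangle (3 + p) * u + triangle (2 + p) ≤ pairTotal L) where

  k s N : ℕ
  s = suc (u + p)
  k = suc s + q
  N = (3 + p) * k

  -- `L` is completed by `m` petals to ℓ members, to which `dense` applies. It is used for lists of
  -- length 0, 1 and 2.
  dense-with-petals : ∀ T → ∣ T ∣ < k → Rich F N T → ∀ m L → m + length L ≡ 3 + p → Unique L → All (_∈ F) L →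
    triangle (3 + p) * u + triangle (2 + p) ≤ pairTotal L + m * sum (map (λ B → ∣ T ∩ B ∣) L) + triangle m * ∣ T ∣
  dense-with-petals T T<k rich m L fits uniqL L⊆F =
    let L′ , len , uniqL′ , L′⊆F , total = add-petals {ℓ = 3 + p} size T<k rich m L (≤-reflexive fits) uniqL L⊆F
    in ≤-trans (dense L′ (trans len fits) uniqL′ L′⊆F) total

  rich⇒size≥t : ∀ T → ∣ T ∣ < k → Rich F N T → u < ∣ T ∣
  rich⇒size≥t T T<k rich = ≰⇒> λ T≤u → no-smaller-kernel c (triangle (2 + p)) u ∣ T ∣ z<s T≤u
    (subst (λ z → c * u + triangle (2 + p) ≤ z + c * ∣ T ∣) (*-zeroʳ (3 + p))
      (dense-with-petals T T<k rich (3 + p) [] (+-identityʳ (3 + p)) [] []))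
    where
    c : ℕ
    c = triangle (3 + p)

  module Kernel (T : Subset n) (∣T∣≡t : ∣ T ∣ ≡ suc u) (rich : Rich F N T) where

    t<k : ∣ T ∣ < k
    t<k = subst (_< k) (sym ∣T∣≡t) (s≤s (s≤s (≤-trans (m≤m+n u p) (m≤m+n (u + p) q))))

    meets≥u : ∀ {B} → B ∈ F → u ≤ ∣ T ∩ B ∣
    meets≥u {B} B∈F = one-outsider p c u ∣ T ∩ B ∣
      (subst (λ t → (2 + p + c) * u + c ≤ 0 + (2 + p) * (∣ T ∩ B ∣ + 0) + c * t) ∣T∣≡t
        (dense-with-petals T t<k rich (2 + p) [ B ] (+-comm (2 + p) 1) ([] ∷ []) (B∈F ∷ [])))
      where
      c : ℕ
      c = triangle (2 + p)

    meets≤u : ∀ {B} → ¬ (T ⊆ B) → ∣ T ∩ B ∣ ≤ u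
    meets≤u {B} T⊈B = ≮⇒≥ λ u<T∩B → T⊈B (∣p∣≤∣p∩q∣⇒p⊆q T B (subst (_≤ ∣ T ∩ B ∣) (sym ∣T∣≡t) u<T∩B))

    s-intersecting : ∀ {B₁ B₂} → B₁ ∈ F → B₂ ∈ F → ¬ (T ⊆ B₁) → ¬ (T ⊆ B₂) → s ≤ ∣ B₁ ∩ B₂ ∣
    s-intersecting {B₁} {B₂} B₁∈F B₂∈F T⊈B₁ T⊈B₂ with ≡-dec Bool._≟_ B₁ B₂
    -- Petals complete only lists of distinct members; for equal ones the intersection has k ≥ s + 1
    -- points.
    ... | yes refl = ≤-trans (≤-trans (n≤1+n s) (m≤m+n (suc s) q))
      (≤-reflexive (sym (trans (cong ∣_∣ (∩-idem B₁)) (size B₁∈F))))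
    ... | no B₁≢B₂ =
      two-outsiders p c u (∣ B₁ ∩ B₂ ∣) (∣ T ∩ B₁ ∣) (∣ T ∩ B₂ ∣) (meets≤u T⊈B₁) (meets≤u T⊈B₂)
        (subst (λ t → (2 + p + (1 + p + c)) * u + (1 + p + c) ≤
            ∣ B₁ ∩ B₂ ∣ + 0 + 0 + (1 + p) * (∣ T ∩ B₁ ∣ + (∣ T ∩ B₂ ∣ + 0)) + c * t) ∣T∣≡t
          (dense-with-petals T t<k rich (1 + p) (B₁ ∷ B₂ ∷ []) (+-comm (1 + p) 2)
            ((B₁≢B₂ ∷ []) ∷ [] ∷ []) (B₁∈F ∷ B₂∈F ∷ [])))
      where
      c : ℕ
      c = triangle (1 + p)

    As Bs : List (Subset n)
    As = filter (T ⊆?_) F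
    Bs = filter (λ B → ¬? (T ⊆? B)) F

    ∈Bs⁻ : ∀ {B} → B ∈ Bs → B ∈ F × ¬ (T ⊆ B)
    ∈Bs⁻ = ∈-filter⁻ (λ B → ¬? (T ⊆? B))

    length-As : length As ≤ (n ∸ suc u) C suc (p + q)
    length-As = ≤-trans
      (covered⇒length≤ (suc u) (suc (p + q)) As [ T ] (filter⁺ (T ⊆?_) uniq)
        (λ A∈As → trans (size (proj₁ (∈-filter⁻ (T ⊆?_) A∈As))) (regroup u p q)) (∣T∣≡t ∷ [])
        (λ {A} A∈As → here (proj₂ (∈-filter⁻ (T ⊆?_) {xs = F} A∈As))))
      (≤-reflexive (+-identityʳ _))
      where
      regroup : ∀ u p q → suc (suc (u + p)) + q ≡ suc u + suc (p + q)
      regroup = solve-∀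

    -- For |S| ≤ s the first condition forces `S` into every member of `Bs`; the second leaves at
    -- most one point of `T` outside `S`.
    Good : Subset n → Set
    Good S = All (λ B → s ≤ ∣ S ∩ B ∣) Bs × u ≤ ∣ S ∩ T ∣

    step : ∀ S → Good S ⊎ ∃ λ X → ∣ X ∣ ≤ N × (∀ {B} → B ∈ Bs → S ⊆ B → ¬ (B ∩ X ⊆ S))
    step S with ∣ S ∩ T ∣ <? u
    -- Every member of `Bs` meets `T` in at least `u` points while `S` does not, so `T` blocks `S`.
    ... | yes few = inj₂ (T , ≤-trans (<⇒≤ t<k) (m≤n*m k (3 + p)) , λ {B} B∈Bs _ →
      ∣∩∣<⇒∩⊈ S B T (subst (u ≤_) (cong ∣_∣ (∩-comm T B)) (meets≥u (proj₁ (∈Bs⁻ B∈Bs)))) few)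
    ... | no enough with Any.any? (λ B → ∣ S ∩ B ∣ <? s) Bs
    ...   | no none = inj₁ (All.map ≮⇒≥ (¬Any⇒All¬ Bs none) , ≮⇒≥ enough)
    -- Likewise `B₀` blocks `S`: it meets every member of `Bs` in at least `s` points, but `S` in
    -- fewer.
    ...   | yes some with find some
    ...     | B₀ , B₀∈Bs , few = inj₂ (B₀ , ≤-trans (≤-reflexive (size B₀∈F)) (m≤n*m k (3 + p)) , λ {B} B∈Bs _ →
      let B∈F , T⊈B = ∈Bs⁻ B∈Bs in ∣∩∣<⇒∩⊈ S B B₀ (s-intersecting B∈F B₀∈F T⊈B T⊈B₀) few)
      where
      B₀∈F = proj₁ (∈Bs⁻ B₀∈Bs)
      T⊈B₀ = proj₂ (∈Bs⁻ B₀∈Bs)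

    -- If `Bs` is nonempty, some `B₀` in it forces |S| = s and misses a point `y` of `T`. All
    -- members of `Bs` contain `S` and avoid `y`, so their other k - s points come from n - s - 1.
    good⇒length-Bs : ∀ S → ∣ S ∣ ≤ s → Good S → length Bs ≤ (n ∸ suc s) C suc q
    good⇒length-Bs S S≤s (heavy , u≤S∩T) with []-or-∈ Bs
    ... | inj₁ empty = subst (_≤ (n ∸ suc s) C suc q) (sym (cong length empty)) z≤n
    ... | inj₂ (B₀ , B₀∈Bs) with ⊈⇒∃ T B₀ (proj₂ (∈Bs⁻ B₀∈Bs))
    ...   | y , y∈T , y∉B₀ = subst (λ i → length Bs ≤ (n ∸ suc i) C suc q) ∣S∣≡s
      (contain-avoid⇒length≤ (suc q) Bs S y (filter⁺ _ uniq) sizes y∉S S⊆ y∉)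
      where
      S⊆ : ∀ {B} → B ∈ Bs → S ⊆ B
      S⊆ {B} B∈Bs = ∣p∣≤∣p∩q∣⇒p⊆q S B (≤-trans S≤s (All.lookup heavy B∈Bs))
      ∣S∣≡s : ∣ S ∣ ≡ s
      ∣S∣≡s = ≤-antisym S≤s (≤-trans (All.lookup heavy B₀∈Bs) (∣p∩q∣≤∣p∣ S B₀))
      sizes : ∀ {B} → B ∈ Bs → ∣ B ∣ ≡ ∣ S ∣ + suc q
      sizes B∈Bs = trans (size (proj₁ (∈Bs⁻ B∈Bs))) (trans (sym (+-suc s q)) (cong (_+ suc q) (sym ∣S∣≡s)))
      y∉S : y ∉ˢ S
      y∉S y∈S = y∉B₀ (S⊆ B₀∈Bs y∈S)
      -- Otherwise B contains S ∩ T and y, hence t elements of T.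
      y∉ : ∀ {B} → B ∈ Bs → y ∉ˢ B
      y∉ {B} B∈Bs y∈B = <⇒≱ (p⊂q⇒∣p∣<∣q∣ (S∩T⊆T∩B , y , x∈p∩q⁺ (y∈T , y∈B) , y∉S ∘ p∩q⊆p S T))
        (≤-trans (meets≤u (proj₂ (∈Bs⁻ B∈Bs))) u≤S∩T)
        where
        S∩T⊆T∩B : S ∩ T ⊆ T ∩ B
        S∩T⊆T∩B x∈ = let x∈S , x∈T = x∈p∩q⁻ S T x∈ in x∈p∩q⁺ (x∈T , S⊆ B∈Bs x∈S)

    -- Without a good set, boundedly many (s + 1)-sets cover `Bs`, and `C-grows` absorbs their
    -- number.
    length-Bs : N ^ suc s * suc q + q ≤ n ∸ suc s → length Bs ≤ (n ∸ suc s) C suc q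
    length-Bs large with Branching.good-or-cover Bs N Good step (suc s)
    ... | inj₁ (S , S<1+s , good) = good⇒length-Bs S (≤-pred S<1+s) good
    ... | inj₂ (Ss , len , sizes , cover) = begin
      length Bs                           ≤⟨ covered⇒length≤ (suc s) q Bs Ss (filter⁺ _ uniq) (size ∘ proj₁ ∘ ∈Bs⁻) sizes cover ⟩
      length Ss * ((n ∸ suc s) C q)       ≤⟨ *-monoˡ-≤ _ len ⟩
      N ^ suc s * ((n ∸ suc s) C q)       ≤⟨ C-grows (N ^ suc s) q (n ∸ suc s) large ⟩
      (n ∸ suc s) C suc q                 ∎
      where open ≤-Reasoning

  length≤ : N ^ (2 + u) * suc (p + q) + (p + q) ≤ n ∸ (2 + u) → N ^ suc s * suc q + q ≤ n ∸ suc s →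
    length F ≤ ((n ∸ suc u) C suc (p + q)) + ((n ∸ suc s) C suc q)
  length≤ large₁ large₂ with Branching.good-or-cover F N (Rich F N) (rich-or-blocked F N) (2 + u)
  ... | inj₁ (T , T<2+u , rich) = ≤-trans (≤-reflexive (length-filter-split (T ⊆?_) F))
    (+-mono-≤ length-As (length-Bs large₂))
    where
    T<k : ∣ T ∣ < k
    T<k = ≤-trans T<2+u (s≤s (s≤s (≤-trans (m≤m+n u p) (m≤m+n (u + p) q))))
    -- Branching to depth t + 1 gives |T| ≤ t, and richness gives |T| ≥ t.
    open Kernel T (≤-antisym (≤-pred T<2+u) (rich⇒size≥t T T<k rich)) rich
  ... | inj₂ (Ts , len , sizes , cover) = begin
    length F                                   ≤⟨ covered⇒length≤ (2 + u) (p + q) F Ts uniq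
                                                    (λ A∈F → trans (size A∈F) (+-assoc (2 + u) p q)) sizes cover ⟩
    length Ts * ((n ∸ (2 + u)) C (p + q))      ≤⟨ *-monoˡ-≤ _ len ⟩
    N ^ (2 + u) * ((n ∸ (2 + u)) C (p + q))    ≤⟨ C-grows (N ^ (2 + u)) (p + q) (n ∸ (2 + u)) large₁ ⟩
    (n ∸ (2 + u)) C suc (p + q)                ≡⟨ cong (_C suc (p + q)) (pred[m∸n]≡m∸[1+n] n (suc u)) ⟨
    pred (n ∸ suc u) C suc (p + q)             ≤⟨ C-mono-pred (n ∸ suc u) (p + q) ⟩
    (n ∸ suc u) C suc (p + q)                  ≤⟨ m≤m+n _ _ ⟩
    ((n ∸ suc u) C suc (p + q)) + ((n ∸ suc s) C suc q) ∎
    where open ≤-Reasoning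

-- Return to the parameters t, ℓ, k and choice of n₀

theorem6 : (t ℓ k : ℕ) → 1 ≤ t → 3 ≤ ℓ → t + ℓ ∸ 2 ≤ k →
    Σ ℕ (λ n₀ → (n : ℕ) → n₀ ≤ n →
    (F : List (Subset n)) → Unique F → All (λ A → ∣ A ∣ ≡ k) F →
    ((G : Fin ℓ → Subset n) → Injective _≡_ _≡_ G → ((i : Fin ℓ) → G i ∈ F) →
    (ℓ C 2) * (t ∸ 1) + ((ℓ ∸ 1) C 2) ≤ pairSum (λ i j → ∣ G i ∩ G j ∣)) →
    length F ≤ ((n ∸ t) C (k ∸ t)) + ((n + 2 ∸ t ∸ ℓ) C (k + 3 ∸ t ∸ ℓ)))
theorem6 (suc u) ℓ@(suc (suc (suc p))) k _ (s≤s (s≤s (s≤s z≤n))) t+ℓ∸2≤k = n₁ + n₂ , bound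
  where
  s q N n₁ n₂ : ℕ
  s = suc (u + p)
  q = k ∸ suc s
  N = (3 + p) * (suc s + q)
  -- The thresholds of `C-grows` for covers by (t + 1)-sets and by (s + 1)-sets, shifted because the
  -- upper arguments are n - t - 1 and n - s - 1.
  n₁ = N ^ (2 + u) * suc (p + q) + (p + q) + (2 + u)
  n₂ = N ^ suc s * suc q + q + suc s

  t+ℓ : ∀ u p → suc u + suc (suc (suc p)) ≡ 4 + (u + p)
  t+ℓ = solve-∀

  k≡ : k ≡ suc s + q
  k≡ = sym (m+[n∸m]≡n (subst (_≤ k) (cong (_∸ 2) (t+ℓ u p)) t+ℓ∸2≤k))

  k∸t : k ∸ suc u ≡ suc (p + q)
  k∸t = trans (cong (_∸ suc u) (trans k≡ (regroup u p q))) (m+n∸m≡n (suc u) (suc (p + q)))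
    where
    regroup : ∀ u p q → suc (suc (u + p)) + q ≡ suc u + suc (p + q)
    regroup = solve-∀

  -- The truncated subtraction is exact, since t + ℓ ≤ k + 2.
  k+3∸t∸ℓ : k + 3 ∸ suc u ∸ ℓ ≡ suc q
  k+3∸t∸ℓ = trans (∸-+-assoc (k + 3) (suc u) ℓ)
    (trans (cong₂ _∸_ (trans (cong (_+ 3) k≡) (regroup u p q)) (t+ℓ u p)) (m+n∸m≡n (4 + (u + p)) (suc q)))
    where
    regroup : ∀ u p q → suc (suc (u + p)) + q + 3 ≡ 4 + (u + p) + suc q
    regroup = solve-∀

  n+2∸t∸ℓ : ∀ n → n + 2 ∸ suc u ∸ ℓ ≡ n ∸ suc s
  n+2∸t∸ℓ n = trans (∸-+-assoc (n + 2) (suc u) ℓ) (cong₂ _∸_ (+-comm n 2) (t+ℓ u p))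

  bound : ∀ n → n₁ + n₂ ≤ n → (F : List (Subset n)) → Unique F → All (λ A → ∣ A ∣ ≡ k) F →
    ((G : Fin ℓ → Subset n) → Injective _≡_ _≡_ G → ((i : Fin ℓ) → G i ∈ F) →
      (ℓ C 2) * u + ((2 + p) C 2) ≤ pairSum (λ i j → ∣ G i ∩ G j ∣)) →
    length F ≤ ((n ∸ suc u) C (k ∸ suc u)) + ((n + 2 ∸ suc u ∸ ℓ) C (k + 3 ∸ suc u ∸ ℓ))
  bound n large F uniq sizes dense = subst₂ (λ x y → length F ≤ ((n ∸ suc u) C x) + y) (sym k∸t)
    (sym (cong₂ _C_ (n+2∸t∸ℓ n) k+3∸t∸ℓ))
    (Bound.length≤ u p q F uniq (λ A∈F → trans (All.lookup sizes A∈F) k≡) dense-list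
      (m+n≤o⇒m≤o∸n _ (m+n≤o⇒m≤o n₁ large)) (m+n≤o⇒m≤o∸n _ (m+n≤o⇒n≤o n₁ large)))
    where
    -- `m` is a variable so that matching on `refl` turns `Fin m` into the domain of `lookup L`.
    on-list : ∀ {m c} (L : List (Subset n)) → length L ≡ m →
      ((G : Fin m → Subset n) → Injective _≡_ _≡_ G → ((i : Fin m) → G i ∈ F) →
        c ≤ pairSum (λ i j → ∣ G i ∩ G j ∣)) →
      Unique L → All (_∈ F) L → c ≤ pairTotal L
    on-list {c = c} L refl family uniqL L⊆F = subst (c ≤_) (pairSum-lookup L)
      (family (lookup L) (lookup-unique-injective uniqL) (λ i → All.lookup L⊆F (∈-lookup i)))
    dense-list : ∀ L → length L ≡ 3 + p → Unique L → All (_∈ F) L →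
      triangle (3 + p) * u + triangle (2 + p) ≤ pairTotal L
    dense-list L len uniqL L⊆F = subst₂ (λ x y → x * u + y ≤ pairTotal L) (nC2≡triangle (3 + p)) (nC2≡triangle (2 + p))
      (on-list L len dense uniqL L⊆F)
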